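{- Let $\mathcal{R}$ be an oriented CTRS. If we can find two conditional narrowing sequences $u \rightsquigarrow_{\sigma}^{*} s$ and $v \rightsquigarrow_{\tau}^{*} t$ with respect to $\mathcal{R}$ such that $u\sigma\mu = v\tau\mu$ for some most general unifier $\mu$ (of $u\sigma$ and $v\tau$), and $s\sigma\mu$ and $t\tau\mu$ are not $\mathcal{R}_{\mathsf{u}}$-joinable (that is, there is no term $w$ with $s\sigma\mu \to_{\mathcal{R}_{\mathsf{u}}}^{*} w$ and $t\tau\mu \to_{\mathcal{R}_{\mathsf{u}}}^{*} w$), then $\mathcal{R}$ is non-confluent.
   Context: Terms are the first-order terms $\mathcal{T}(\mathcal{F},\mathcal{V})$ over a signature $\mathcal{F}$ of function symbols and a set of variables $\mathcal{V}$. For a syntactic object $o$, $\mathcal{V}(o)$ denotes the set of variables occurring in $o$; $\mathcal{P}\mathsf{os}_{\mathcal{F}}(s)$ denotes the set of positions of the term $s$ at which a function symbol occurs; $s|_p$ is the subterm of $s$ at position $p$, and $s[r]_p$ is the result of replacing it by $r$. Substitutions are applied in postfix notation, and $\sigma_1\sigma_2$ means first $\sigma_1$, then $\sigma_2$. A unifier of two terms $a$ and $b$ is a substitution $\sigma$ with $a\sigma = b\sigma$. A conditional term rewrite system (CTRS) $\mathcal{R}$ is a set of conditional rewrite rules $\ell \to r \Leftarrow c$ where $\ell, r$ are terms, $\ell \notin \mathcal{V}$, and $c$ is a (possibly empty) sequence of pairs of terms $s_1 \approx t_1, \ldots, s_k \approx t_k$. Right-hand sides may contain variables that occur neither in the left-hand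 side nor in the conditions. All CTRSs are oriented: conditions are interpreted as reachability requirements. For each level $i$ an (unconditional) term rewrite system (TRS) $\mathcal{R}_i$ is defined by $\mathcal{R}_0 = \varnothing$ and $\mathcal{R}_{i+1} = \{\ell\sigma \to r\sigma \mid (\ell \to r \Leftarrow c) \in \mathcal{R},\ \sigma \text{ a substitution},\ s\sigma \to_{\mathcal{R}_i}^{*} t\sigma \text{ for all } s \approx t \text{ in } c\}$. The rewrite relation of $\mathcal{R}$ is $\to_{\mathcal{R}} = \bigcup_{i \geq 0} \to_{\mathcal{R}_i}$, where the rewrite relation of a TRS is as usual (closed under contexts and substitutions), and ${}^{*}$ denotes reflexive transitive closure. The underlying TRS $\mathcal{R}_{\mathsf{u}}$ is obtained from $\mathcal{R}$ by dropping all conditions: $\mathcal{R}_{\mathsf{u}} = \{\ell \to r \mid (\ell \to r \Leftarrow c) \in \mathcal{R}\}$. Conditional narrowing: a term $s$ (conditionally) narrows to $t$, written $s \rightsquigarrow_{\sigma} t$, if there are a variant $\rho\colon \ell \to r \Leftarrow c$ of a rule in $\mathcal{R}$ (its image under a bijective variable renaming) with $\mathcal{V}(s) \cap \mathcal{V}(\rho) = \varnothing$ and $a \rightsquigarrow_{\sigma}^{*} b$ for all $a \approx b$ in $c$, a position $p \in \mathcal{P}\mathsf{os}_{\mathcal{F}}(s)$, and a unifier $\sigma$ of $s|_p$ and $\ell$, such that $t = s[r]_p\sigma$. For a narrowing sequence $s_1 \rightsquigarrow_{\sigma_1} s_2 \rightsquigarrow_{\sigma_2} \cdots \rightsquigarrow_{\sigma_{n-1}}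 s_n$ one writes $s_1 \rightsquigarrow_{\sigma}^{*} s_n$ where $\sigma = \sigma_1\sigma_2\cdots\sigma_{n-1}$. In every narrowing step, the variables of the rule variant used are required to be fresh with respect to all previous terms and rules. $\mathcal{R}$ is confluent if whenever $s \to_{\mathcal{R}}^{*} t$ and $s \to_{\mathcal{R}}^{*} u$ there is a term $w$ with $t \to_{\mathcal{R}}^{*} w$ and $u \to_{\mathcal{R}}^{*} w$; it is non-confluent if it is not confluent.
   Formalization: The composed substitution of each narrowing sequence (including those for conditions) is required to be idempotent; with arbitrary unifiers the claim fails, e.g. for f(y) → f(y), u = f(x), σ = {x ↦ f(x), y ↦ f(x)}, v = t = f(f(x)). -}

module Defs where

open import Level using (0ℓ)
open import Data.Empty using (⊥)
open import Data.Fin using (Fin)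
open import Data.List using (List; []; _∷_; _++_; map; concatMap)
open import Data.List.Relation.Binary.Disjoint.Propositional using (Disjoint)
open import Data.List.Relation.Unary.All using (All)
open import Data.Nat using (ℕ; zero; suc)
open import Data.Product using (_×_; _,_; ∃; ∃-syntax)
open import Data.Vec using (Vec; []; _∷_; lookup; _[_]≔_)
open import Function.Bundles using (_⤖_; module Bijection)
open import Relation.Binary.Construct.Closure.ReflexiveTransitive using (Star)
open import Relation.Binary.Core using (Rel)
open import Relation.Binary.PropositionalEquality using (_≡_; _≗_)
open import Relation.Unary using (Pred; _∈_)

infixl 8 _·_ _·*_
infixl 9 _⨾_
infix 10 _∣_

record Signature : Set₁ where
  field
    Symbol : Set
    arity  : Symbol → ℕ

open Signature public

data Term (𝓕 : Signature) (𝓥 : Set) : Set where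
  var : 𝓥 → Term 𝓕 𝓥
  fun : (f : Symbol 𝓕) → Vec (Term 𝓕 𝓥) (arity 𝓕 f) → Term 𝓕 𝓥

Subst : Signature → Set → Set
Subst 𝓕 𝓥 = 𝓥 → Term 𝓕 𝓥

Conditions : Signature → Set → Set
Conditions 𝓕 𝓥 = List (Term 𝓕 𝓥 × Term 𝓕 𝓥)

record Rule (𝓕 : Signature) (𝓥 : Set) : Set where
  constructor _⟶_⇐_
  field
    lhs   : Term 𝓕 𝓥
    rhs   : Term 𝓕 𝓥
    conds : Conditions 𝓕 𝓥

open Rule public

-- T ℓ r means that ℓ → r is a rule of T; T is not the rewrite relation.
TRS : Signature → Set → Set₁
TRS 𝓕 𝓥 = Rel (Term 𝓕 𝓥) 0ℓ

data IsFun {𝓕 : Signature} {𝓥 : Set} : Term 𝓕 𝓥 → Set where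
  isFun : ∀ {f ts} → IsFun (fun f ts)

record CTRS (𝓕 : Signature) (𝓥 : Set) : Set₁ where
  field
    Rules     : Pred (Rule 𝓕 𝓥) 0ℓ
    lhs-isFun : ∀ {ρ} → ρ ∈ Rules → IsFun (lhs ρ)

open CTRS public

private variable
  𝓕 : Signature
  𝓥 : Set

vars  : Term 𝓕 𝓥 → List 𝓥
vars* : ∀ {n} → Vec (Term 𝓕 𝓥) n → List 𝓥
vars (var x)    = x ∷ []
vars (fun f ts) = vars* ts
vars* []        = []
vars* (t ∷ ts)  = vars t ++ vars* ts

varsRule : Rule 𝓕 𝓥 → List 𝓥
varsRule (ℓ ⟶ r ⇐ c) =
  vars ℓ ++ vars r ++ concatMap (λ (a , b) → vars a ++ vars b) c

_·_  : Term 𝓕 𝓥 → Subst 𝓕 𝓥 → Term 𝓕 𝓥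
_·*_ : ∀ {n} → Vec (Term 𝓕 𝓥) n → Subst 𝓕 𝓥 → Vec (Term 𝓕 𝓥) n
var x    · σ  = σ x
fun f ts · σ  = fun f (ts ·* σ)
[]       ·* σ = []
(t ∷ ts) ·* σ = t · σ ∷ ts ·* σ

-- First σ, then τ.
_⨾_ : Subst 𝓕 𝓥 → Subst 𝓕 𝓥 → Subst 𝓕 𝓥
(σ ⨾ τ) x = σ x · τ

Idempotent : Subst 𝓕 𝓥 → Set
Idempotent σ = σ ⨾ σ ≗ σ

IsUnifier : Subst 𝓕 𝓥 → Term 𝓕 𝓥 → Term 𝓕 𝓥 → Set
IsUnifier σ a b = a · σ ≡ b · σ

IsMGU : Subst 𝓕 𝓥 → Term 𝓕 𝓥 → Term 𝓕 𝓥 → Set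
IsMGU μ a b = IsUnifier μ a b × (∀ θ → IsUnifier θ a b → ∃[ δ ] θ ≗ μ ⨾ δ)

data Pos {𝓕 : Signature} {𝓥 : Set} : Term 𝓕 𝓥 → Set where
  root : ∀ {t} → Pos t
  arg  : ∀ {f ts} (i : Fin (arity 𝓕 f)) → Pos (lookup ts i) → Pos (fun f ts)

_∣_ : (t : Term 𝓕 𝓥) → Pos t → Term 𝓕 𝓥
t        ∣ root    = t
fun f ts ∣ arg i p = lookup ts i ∣ p

_[_≔_] : (t : Term 𝓕 𝓥) → Pos t → Term 𝓕 𝓥 → Term 𝓕 𝓥
t        [ root    ≔ r ] = r
fun f ts [ arg i p ≔ r ] = fun f (ts [ i ]≔ (lookup ts i [ p ≔ r ]))

record Rewrite (T : TRS 𝓕 𝓥) (s t : Term 𝓕 𝓥) : Set where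
  constructor rewriteAt
  field
    {left right} : Term 𝓕 𝓥
    inTRS        : T left right
    pos          : Pos s
    σ            : Subst 𝓕 𝓥
    redex        : s ∣ pos ≡ left · σ
    result       : t ≡ s [ pos ≔ right · σ ]

Joinable : TRS 𝓕 𝓥 → Rel (Term 𝓕 𝓥) 0ℓ
Joinable T s t = ∃[ w ] Star (Rewrite T) s w × Star (Rewrite T) t w

underlying : CTRS 𝓕 𝓥 → TRS 𝓕 𝓥
underlying R ℓ r = ∃[ c ] (ℓ ⟶ r ⇐ c) ∈ Rules R

-- Conditions are read as reachability at the previous level (oriented CTRS).
level : CTRS 𝓕 𝓥 → ℕ → TRS 𝓕 𝓥
level R zero    _ _ = ⊥
level R (suc i) l r = ∃[ ρ ] ∃[ σ ]
  ρ ∈ Rules R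
  × l ≡ lhs ρ · σ
  × r ≡ rhs ρ · σ
  × All (λ (a , b) → Star (Rewrite (level R i)) (a · σ) (b · σ)) (conds ρ)

RewriteC : CTRS 𝓕 𝓥 → Rel (Term 𝓕 𝓥) 0ℓ
RewriteC R s t = ∃[ i ] Rewrite (level R i) s t

renameRule : 𝓥 ⤖ 𝓥 → Rule 𝓕 𝓥 → Rule 𝓕 𝓥
renameRule {𝓥 = 𝓥} {𝓕 = 𝓕} π (ℓ ⟶ r ⇐ c) =
  (ℓ · π′) ⟶ (r · π′) ⇐ map (λ (a , b) → (a · π′ , b · π′)) c
  where
  π′ : Subst 𝓕 𝓥
  π′ x = var (Bijection.to π x)

Variant : CTRS 𝓕 𝓥 → Pred (Rule 𝓕 𝓥) 0ℓ
Variant {𝓥 = 𝓥} R ρ = ∃[ π ] ∃[ ρ₀ ] ρ₀ ∈ Rules R × ρ ≡ renameRule {𝓥 = 𝓥} π ρ₀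

-- To express freshness, every relation below carries the list H of the
-- variables of all terms and rules used before it and the list H′ of those
-- used after it.  Within a step, the variant ρ is chosen first, then its
-- conditions are narrowed from left to right.
mutual

  record Step (R : CTRS 𝓕 𝓥) (H : List 𝓥) (s : Term 𝓕 𝓥) (σ : Subst 𝓕 𝓥)
              (t : Term 𝓕 𝓥) (H′ : List 𝓥) : Set where
    inductive
    constructor narrowAt
    field
      ρ          : Rule 𝓕 𝓥
      variant    : Variant R ρ
      disjoint   : Disjoint (vars s) (varsRule ρ)
      fresh      : Disjoint H (varsRule ρ)
      {H₁}       : List 𝓥
      conditions : NarrowConds R (varsRule ρ ++ H) σ (conds ρ) H₁
      pos        : Pos s
      pos-isFun  : IsFun (s ∣ pos)
      unifier    : IsUnifier σ (s ∣ pos) (lhs ρ)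
      result     : t ≡ (s [ pos ≔ rhs ρ ]) · σ
      history    : H′ ≡ vars t ++ H₁

  -- The same σ is used for the step and for all of its conditions.
  data NarrowConds (R : CTRS 𝓕 𝓥) (H : List 𝓥) (σ : Subst 𝓕 𝓥) :
                   Conditions 𝓕 𝓥 → List 𝓥 → Set where
    []  : NarrowConds R H σ [] H
    _∷_ : ∀ {a b c H₁ H₂} → Narrow R H a σ b H₁ → NarrowConds R H₁ σ c H₂ →
          NarrowConds R H σ ((a , b) ∷ c) H₂

  data Steps (R : CTRS 𝓕 𝓥) (H : List 𝓥) :
             Term 𝓕 𝓥 → Subst 𝓕 𝓥 → Term 𝓕 𝓥 → List 𝓥 → Set where
    done : ∀ {s σ} → σ ≗ var → Steps R H s σ s H
    step : ∀ {s t u σ₁ σ₂ σ H₁ H₂} → Step R H s σ₁ t H₁ → Steps R H₁ t σ₂ u H₂ →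
           σ ≗ σ₁ ⨾ σ₂ → Steps R H s σ u H₂

  -- The substitution of a narrowing sequence is required to be idempotent.
  -- This holds automatically if every unifier is an idempotent mgu, but not
  -- for arbitrary unifiers.  Without it the steps only give sσ →* t, not
  -- sσ →* tσ: for the rule f(y) → f(y) and σ = {x ↦ f(x), y ↦ f(x)}, the term
  -- f(x) narrows to t = f(f(x)), but f(x)σ = f(f(x)) has no reduct other than
  -- itself, and tσ = f(f(f(x))).
  record Narrow (R : CTRS 𝓕 𝓥) (H : List 𝓥) (s : Term 𝓕 𝓥) (σ : Subst 𝓕 𝓥)
                (t : Term 𝓕 𝓥) (H′ : List 𝓥) : Set where
    inductive
    constructor narrow
    field
      steps      : Steps R H s σ t H′
      idempotent : Idempotent σ

infix 3 _⊢_⇝*[_]_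

_⊢_⇝*[_]_ : CTRS 𝓕 𝓥 → Term 𝓕 𝓥 → Subst 𝓕 𝓥 → Term 𝓕 𝓥 → Set
R ⊢ s ⇝*[ σ ] t = ∃[ H ] Narrow R (vars s) s σ t H

{-# OPTIONS --safe #-}
-- A narrowing step s ⇝ t with unifier σ₁ is a rewrite step sσ₁ → t, so by closure under
-- substitutions a narrowing sequence s ⇝* t with substitution σ gives sσ →* t; instantiating
-- with σ once more and using σσ = σ yields sσ →* tσ.  Applied to the conditions of the rule
-- variants, this is also what licenses the conditional rewrite steps.  Hence
-- sσμ *← uσμ = vτμ →* tτμ is a peak of R, and any R-join of it is an Rᵤ-join.
module Submission where

open import Defs
open import Data.List.Relation.Unary.All as All using (All; []; _∷_)
open import Data.List.Relation.Unary.All.Properties using (map⁻)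
open import Data.Nat using (ℕ; suc; _≤_; s≤s; _⊔_)
open import Data.Nat.Properties using (m≤m⊔n; m≤n⊔m)
open import Data.Product using (_×_; _,_; ∃-syntax)
open import Data.Vec using (Vec; []; _∷_; lookup; map; _[_]≔_)
open import Data.Vec.Properties using (lookup-map; map-[]≔)
open import Function.Bundles using (module Bijection)
open import Relation.Binary.Construct.Closure.ReflexiveTransitive as Star
  using (Star; ε; _◅_)
open import Relation.Binary.Core using (_⇒_)
open import Relation.Binary.PropositionalEquality
  using (_≡_; _≗_; refl; sym; trans; cong; cong₂; subst; subst₂; module ≡-Reasoning)
open import Relation.Binary.Rewriting using (Confluent)
open import Relation.Nullary using (¬_)

private variable
  𝓕 : Signature
  𝓥 : Set

·-cong  : {σ τ : Subst 𝓕 𝓥} → σ ≗ τ → (t : Term 𝓕 𝓥) → t · σ ≡ t · τ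
·*-cong : {σ τ : Subst 𝓕 𝓥} → σ ≗ τ → ∀ {n} (ts : Vec (Term 𝓕 𝓥) n) → ts ·* σ ≡ ts ·* τ
·-cong  e (var x)    = e x
·-cong  e (fun f ts) = cong (fun f) (·*-cong e ts)
·*-cong e []         = refl
·*-cong e (t ∷ ts)   = cong₂ _∷_ (·-cong e t) (·*-cong e ts)

·-identity  : (t : Term 𝓕 𝓥) → t · var ≡ t
·*-identity : ∀ {n} (ts : Vec (Term 𝓕 𝓥) n) → ts ·* var ≡ ts
·-identity  (var x)    = refl
·-identity  (fun f ts) = cong (fun f) (·*-identity ts)
·*-identity []         = refl
·*-identity (t ∷ ts)   = cong₂ _∷_ (·-identity t) (·*-identity ts)

·-⨾  : (σ τ : Subst 𝓕 𝓥) (t : Term 𝓕 𝓥) → t · (σ ⨾ τ) ≡ t · σ · τ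
·*-⨾ : (σ τ : Subst 𝓕 𝓥) → ∀ {n} (ts : Vec (Term 𝓕 𝓥) n) → ts ·* (σ ⨾ τ) ≡ ts ·* σ ·* τ
·-⨾  σ τ (var x)    = refl
·-⨾  σ τ (fun f ts) = cong (fun f) (·*-⨾ σ τ ts)
·*-⨾ σ τ []         = refl
·*-⨾ σ τ (t ∷ ts)   = cong₂ _∷_ (·-⨾ σ τ t) (·*-⨾ σ τ ts)

-- `_·*_` has its own recursion instead of going through `map`; identifying the two gives access to
-- the library facts on lookup and update in a mapped vector.
·*-map : (σ : Subst 𝓕 𝓥) → ∀ {n} (ts : Vec (Term 𝓕 𝓥) n) → ts ·* σ ≡ map (_· σ) ts
·*-map σ []       = refl
·*-map σ (t ∷ ts) = cong (t · σ ∷_) (·*-map σ ts)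

lookup-·* : (σ : Subst 𝓕 𝓥) → ∀ {n} (ts : Vec (Term 𝓕 𝓥) n) i →
            lookup (ts ·* σ) i ≡ lookup ts i · σ
lookup-·* σ ts i = trans (cong (λ us → lookup us i) (·*-map σ ts)) (lookup-map i (_· σ) ts)

[]≔-·* : (σ : Subst 𝓕 𝓥) → ∀ {n} (ts : Vec (Term 𝓕 𝓥) n) i t →
         (ts [ i ]≔ t) ·* σ ≡ (ts ·* σ) [ i ]≔ (t · σ)
[]≔-·* σ ts i t = begin
  (ts [ i ]≔ t) ·* σ           ≡⟨ ·*-map σ (ts [ i ]≔ t) ⟩
  map (_· σ) (ts [ i ]≔ t)     ≡⟨ map-[]≔ (_· σ) ts i ⟩
  map (_· σ) ts [ i ]≔ (t · σ) ≡⟨ cong (_[ i ]≔ (t · σ)) (·*-map σ ts) ⟨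
  (ts ·* σ) [ i ]≔ (t · σ)     ∎
  where open ≡-Reasoning

-- Stated for any s′ equal to sσ, since lookup (ts ·* σ) i and lookup ts i · σ are only
-- propositionally equal.
instantiate-pos : (σ : Subst 𝓕 𝓥) {s s′ : Term 𝓕 𝓥} (p : Pos s) → s′ ≡ s · σ →
  ∃[ q ] s′ ∣ q ≡ (s ∣ p) · σ × (∀ r → (s [ p ≔ r ]) · σ ≡ s′ [ q ≔ r · σ ])
instantiate-pos σ root refl = root , refl , λ r → refl
instantiate-pos σ (arg {f} {ts} i p) refl
  with q , ∣-eq , ≔-eq ← instantiate-pos σ p (lookup-·* σ ts i) =
  arg i q , ∣-eq , λ r → cong (fun f)
    (trans ([]≔-·* σ ts i _) (cong ((ts ·* σ) [ i ]≔_) (≔-eq r)))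

Rewrite-· : {T : TRS 𝓕 𝓥} (τ : Subst 𝓕 𝓥) {s t : Term 𝓕 𝓥} →
            Rewrite T s t → Rewrite T (s · τ) (t · τ)
Rewrite-· τ (rewriteAt {l} {r} l→r p σ redex refl)
  with q , ∣-eq , ≔-eq ← instantiate-pos τ p refl =
  rewriteAt l→r q (σ ⨾ τ)
    (trans ∣-eq (trans (cong (_· τ) redex) (sym (·-⨾ σ τ l))))
    (trans (≔-eq (r · σ)) (cong (_ [ q ≔_]) (sym (·-⨾ σ τ r))))

Rewrite-mono : {T U : TRS 𝓕 𝓥} → T ⇒ U → Rewrite T ⇒ Rewrite U
Rewrite-mono T⊆U (rewriteAt l→r p σ redex result) = rewriteAt (T⊆U l→r) p σ redex result

module _ (R : CTRS 𝓕 𝓥) where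

  -- Induction on `i ≤ j`: the conditions of a rule used at level `suc i` are rewrite sequences at
  -- level `i`, which the induction hypothesis lifts. The case `z≤n` is absent because level 0 has
  -- no rules.
  level-mono : ∀ {i j} → i ≤ j → level R i ⇒ level R j
  level-mono (s≤s i≤j) (ρ , σ , ρ∈R , l≡ , r≡ , cs) =
    ρ , σ , ρ∈R , l≡ , r≡ , All.map (Star.map (Rewrite-mono (level-mono i≤j))) cs

  -- Each step of `RewriteC` may come with its own level, whereas conditions must hold at a single
  -- one; a sequence is finite, so the maximum of its levels serves for all its steps.
  bounded-level : ∀ {s t} → Star (RewriteC R) s t → ∃[ i ] Star (Rewrite (level R i)) s t
  bounded-level ε = 0 , ε
  bounded-level ((i , s→t) ◅ t→*u) with j , t→*u′ ← bounded-level t→*u =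
    i ⊔ j , Rewrite-mono (level-mono (m≤m⊔n i j)) s→t
          ◅ Star.map (Rewrite-mono (level-mono (m≤n⊔m i j))) t→*u′

  RewriteC*-· : (τ : Subst 𝓕 𝓥) → ∀ {s t} →
                Star (RewriteC R) s t → Star (RewriteC R) (s · τ) (t · τ)
  RewriteC*-· τ = Star.gmap (_· τ) λ (i , s→t) → i , Rewrite-· τ s→t

  RewriteC⇒underlying : RewriteC R ⇒ Rewrite (underlying R)
  RewriteC⇒underlying
    (suc i , rewriteAt ((ℓ ⟶ r ⇐ c) , σ , ρ∈R , refl , refl , _) p τ redex refl) =
    -- Rules of a level are already instances of rules of `R`, so the `σ` of the level and the `τ`
    -- of the rewrite step compose.
    rewriteAt (c , ρ∈R) p (σ ⨾ τ)
      (trans redex (sym (·-⨾ σ τ ℓ)))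
      (cong (_ [ p ≔_]) (sym (·-⨾ σ τ r)))

  HoldsAt : ℕ → Subst 𝓕 𝓥 → Conditions 𝓕 𝓥 → Set
  HoldsAt i σ = All λ (a , b) → Star (Rewrite (level R i)) (a · σ) (b · σ)

  -- The renaming is absorbed into the substitution: instantiating the variant by `σ` is
  -- instantiating `ρ₀` by `π′ ⨾ σ`.
  variant-level : ∀ {ρ i σ} → Variant R ρ → HoldsAt i σ (conds ρ) →
                  level R (suc i) (lhs ρ · σ) (rhs ρ · σ)
  variant-level {i = i} {σ} (π , ρ₀ , ρ₀∈R , refl) holds =
    ρ₀ , π′ ⨾ σ , ρ₀∈R , sym (·-⨾ π′ σ (lhs ρ₀)) , sym (·-⨾ π′ σ (rhs ρ₀)) ,
    All.map (λ {(a , b)} → subst₂ (Star (Rewrite (level R i)))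
                             (sym (·-⨾ π′ σ a)) (sym (·-⨾ π′ σ b)))
            (map⁻ holds)
    where
    π′ : Subst 𝓕 𝓥
    π′ x = var (Bijection.to π x)

  mutual

    -- Conditions are themselves solved by narrowing sequences, so all four relations are treated by
    -- one simultaneous induction on derivations.
    Step-sound : ∀ {H s σ t H′} → Step R H s σ t H′ → RewriteC R (s · σ) t
    Step-sound {σ = σ} (narrowAt ρ variant _ _ conditions p _ unifier refl _)
      with i , holds ← NarrowConds-sound conditions
         | q , ∣-eq , ≔-eq ← instantiate-pos σ p refl =
      -- One level above the conditions. The rule taken from that level is already instantiated by
      -- `σ`, so it is applied with the identity `var`.
      suc i , rewriteAt (variant-level variant holds) q var
        (trans ∣-eq (trans unifier (sym (·-identity _))))
        (trans (≔-eq (rhs ρ)) (cong (_ [ q ≔_]) (sym (·-identity _))))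

    NarrowConds-sound : ∀ {H σ c H′} → NarrowConds R H σ c H′ → ∃[ i ] HoldsAt i σ c
    NarrowConds-sound [] = 0 , []
    NarrowConds-sound (n ∷ ns)
      with i , a→*b ← bounded-level (Narrow-sound n)
         | j , holds ← NarrowConds-sound ns =
      i ⊔ j , Star.map (Rewrite-mono (level-mono (m≤m⊔n i j))) a→*b
            ∷ All.map (Star.map (Rewrite-mono (level-mono (m≤n⊔m i j)))) holds

    Steps-sound : ∀ {H s σ t H′} → Steps R H s σ t H′ → Star (RewriteC R) (s · σ) t
    Steps-sound {s = s} (done σ≗var) =
      subst (λ s′ → Star (RewriteC R) s′ s) (sym (trans (·-cong σ≗var s) (·-identity s))) ε
    Steps-sound {s = s} (step {u = u} {σ₁} {σ₂} st sts σ≗) =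
      subst (λ s′ → Star (RewriteC R) s′ u) (sym (trans (·-cong σ≗ s) (·-⨾ σ₁ σ₂ s)))
        -- Instantiated by `σ₂`, the first step ends where the rewrite sequence obtained from the
        -- remaining steps begins.
        (RewriteC*-· σ₂ (Step-sound st ◅ ε) Star.◅◅ Steps-sound sts)

    Narrow-sound : ∀ {H s σ t H′} → Narrow R H s σ t H′ → Star (RewriteC R) (s · σ) (t · σ)
    Narrow-sound {s = s} {σ} {t} (narrow sts idem) =
      subst (λ s′ → Star (RewriteC R) s′ (t · σ))
        (trans (sym (·-⨾ σ σ s)) (·-cong idem s))
        (RewriteC*-· σ (Steps-sound sts))

lemma7 : {𝓕 : Signature} {𝓥 : Set} (R : CTRS 𝓕 𝓥)
    (u v s t : Term 𝓕 𝓥) (σ τ μ : Subst 𝓕 𝓥) →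
    R ⊢ u ⇝*[ σ ] s →
    R ⊢ v ⇝*[ τ ] t →
    IsMGU μ (u · σ) (v · τ) →
    ¬ Joinable (underlying R) (s · σ · μ) (t · τ · μ) →
    ¬ Confluent (RewriteC R)
lemma7 R u v s t σ τ μ (_ , u⇝s) (_ , v⇝t) (uσμ≡vτμ , _) ¬join confluent
  with w , s→*w , t→*w ← confluent
         (RewriteC*-· R μ (Narrow-sound R u⇝s))
         (subst (λ x → Star (RewriteC R) x (t · τ · μ)) (sym uσμ≡vτμ)
           (RewriteC*-· R μ (Narrow-sound R v⇝t))) =
  ¬join (w , Star.map (RewriteC⇒underlying R) s→*w , Star.map (RewriteC⇒underlying R) t→*w)
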